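{- Let $n\ge 1$ and $m\ge 1$ be relatively prime integers with $m\le n$. Then for any prime $p$ and any integer $\alpha\ge 1$, $$\binom{np^{\alpha}}{mp^{\alpha}}\equiv\binom{n}{m}\pmod{np}.$$ -}

module Defs where

open import Data.Integer.Base using (+_; _-_)
open import Data.Integer.Divisibility using (_∣_)
open import Data.Nat.Base using (ℕ)

infix 4 _≡_[mod_]

-- The difference is taken in ℤ, since subtraction in ℕ truncates.
_≡_[mod_] : ℕ → ℕ → ℕ → Set
a ≡ b [mod k ] = + k ∣ + a - + b

{-# OPTIONS --safe #-}
-- Write N = n p^α and M = m p^α, and let D be the difference of the two binomials. Absorption,
-- k C(n, k) = n C(n-1, k-1), gives m D = n (C(N-1, M-1) - C(n-1, m-1)), and Lucas' congruence, applied
-- to indices ending in the digit p-1 and then in the digit 0, shows that p divides both the bracket and D.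
-- So n p ∣ m D, whence n ∣ D, say D = q n, and p ∣ m q. If p ∣ m instead of p ∣ q, then p ∤ n by
-- coprimality, and p ∣ D still forces p ∣ q.
module Submission where

open import Defs
open import Data.Nat.Base using (ℕ; _*_; _^_; _≤_)
open import Data.Nat.Combinatorics using (_C_)
open import Data.Nat.Coprimality using (Coprime)
open import Data.Nat.Primality using (Prime)

open import Data.Integer.Base as ℤ using (+_; ∣_∣)
import Data.Integer.Divisibility.Signed as Signed
import Data.Integer.Properties as ℤ
open import Data.Integer.Tactic.RingSolver using () renaming (solve-∀ to ℤ-solve-∀)
open import Data.Nat.Base using (zero; suc; pred; _+_; _<_; s≤s; z≤n; s<s; NonZero; >-nonZero; ≢-nonZero⁻¹)
open import Data.Nat.Combinatorics using (nCn≡1; nC1≡n; k>n⇒nCk≡0; nCk+nC[k+1]≡[n+1]C[k+1])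
open import Data.Nat.Coprimality using (coprime-divisor)
open import Data.Nat.DivMod using (_/_; _%_; %-distribˡ-+; m≡m%n+[m/n]*n)
open import Data.Nat.Divisibility
open import Data.Nat.Primality using (euclidsLemma; prime⇒nonZero; ¬prime[1])
open import Data.Nat.Properties
open import Data.Nat.Tactic.RingSolver using (solve-∀)
open import Data.Product.Base using (_,_)
open import Data.Sum.Base using (inj₁; inj₂)
open import Relation.Binary.PropositionalEquality
open import Relation.Nullary.Negation using (contradiction)

-- Absorption for binomial coefficients.

[1+k]*[1+n]C[1+k]≡[1+n]*nCk : ∀ n k → suc k * (suc n C suc k) ≡ suc n * (n C k)
[1+k]*[1+n]C[1+k]≡[1+n]*nCk n zero = begin
  1 * (suc n C 1) ≡⟨ *-identityˡ _ ⟩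
  suc n C 1       ≡⟨ nC1≡n (suc n) ⟩
  suc n           ≡⟨ *-identityʳ (suc n) ⟨
  suc n * 1       ∎
  where open ≡-Reasoning
[1+k]*[1+n]C[1+k]≡[1+n]*nCk zero (suc k) = begin
  suc (suc k) * (1 C suc (suc k)) ≡⟨ cong (suc (suc k) *_) (k>n⇒nCk≡0 (s<s (s≤s (z≤n {k})))) ⟩
  suc (suc k) * 0                 ≡⟨ *-zeroʳ (suc (suc k)) ⟩
  1 * 0                           ≡⟨ cong (1 *_) (k>n⇒nCk≡0 (s≤s (z≤n {k}))) ⟨
  1 * (0 C suc k)                 ∎
  where open ≡-Reasoning
[1+k]*[1+n]C[1+k]≡[1+n]*nCk (suc n) (suc k) = begin
  suc (suc k) * (suc (suc n) C suc (suc k))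
    ≡⟨ cong (suc (suc k) *_) (nCk+nC[k+1]≡[n+1]C[k+1] (suc n) (suc k)) ⟨
  suc (suc k) * (c + (suc n C suc (suc k)))
    ≡⟨ *-distribˡ-+ (suc (suc k)) c _ ⟩
  -- One copy of `c` is set aside. The induction hypotheses at `k` and `suc k` recombine by Pascal's
  -- rule into `suc n * c`, and the spare copy raises the factor to `suc (suc n)`.
  (c + suc k * c) + suc (suc k) * (suc n C suc (suc k))
    ≡⟨ cong₂ (λ x y → (c + x) + y) ([1+k]*[1+n]C[1+k]≡[1+n]*nCk n k)
                                   ([1+k]*[1+n]C[1+k]≡[1+n]*nCk n (suc k)) ⟩
  (c + suc n * (n C k)) + suc n * (n C suc k)
    ≡⟨ +-assoc c _ _ ⟩
  c + (suc n * (n C k) + suc n * (n C suc k))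
    ≡⟨ cong (λ x → c + x) (*-distribˡ-+ (suc n) (n C k) (n C suc k)) ⟨
  c + suc n * ((n C k) + (n C suc k))
    ≡⟨ cong (λ x → c + suc n * x) (nCk+nC[k+1]≡[n+1]C[k+1] n k) ⟩
  suc (suc n) * c ∎
  where
  open ≡-Reasoning
  c = suc n C suc k

-- The form with `pred` applies to indices such as `n * p ^ α` that are not syntactically
-- successors.
k*nCk≡n*[n-1]C[k-1] : ∀ n k .{{_ : NonZero n}} .{{_ : NonZero k}} →
                      k * (n C k) ≡ n * (pred n C pred k)
k*nCk≡n*[n-1]C[k-1] (suc n) (suc k) = [1+k]*[1+n]C[1+k]≡[1+n]*nCk n k

-- By absorption `p` divides `suc k * (p C suc k)`, and it cannot divide the smaller positive number
-- `suc k`.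
p∣pC[1+k] : ∀ {p k} → Prime p → suc k < p → p ∣ p C suc k
p∣pC[1+k] {suc q} {k} pp k<p with euclidsLemma (suc k) (suc q C suc k) pp
  (divides (q C k) (trans ([1+k]*[1+n]C[1+k]≡[1+n]*nCk q k) (*-comm (suc q) (q C k))))
... | inj₁ p∣k = contradiction p∣k (>⇒∤ k<p)
... | inj₂ p∣C = p∣C

-- Congruences modulo p and Lucas' theorem.

+-%-cong : ∀ {a b c d} p .{{_ : NonZero p}} →
           a % p ≡ b % p → c % p ≡ d % p → (a + c) % p ≡ (b + d) % p
+-%-cong {a} {b} {c} {d} p a≡b c≡d = begin
  (a + c) % p             ≡⟨ %-distribˡ-+ a c p ⟩
  (a % p + c % p) % p     ≡⟨ cong₂ (λ x y → (x + y) % p) a≡b c≡d ⟩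
  (b % p + d % p) % p     ≡⟨ %-distribˡ-+ b d p ⟨
  (b + d) % p             ∎
  where open ≡-Reasoning

-- Passes from remainders, in which the inductions on Pascal's rule are done, to the integer
-- congruence. Equal remainders cancel, so the cofactor is the difference of the quotients.
%-≡⇒≡[mod] : ∀ {a b} p .{{_ : NonZero p}} → a % p ≡ b % p → a ≡ b [mod p ]
%-≡⇒≡[mod] {a} {b} p eq = Signed.∣⇒∣ᵤ (Signed.divides (+ (a / p) ℤ.- + (b / p)) (begin
  + a ℤ.- + b
    ≡⟨ cong₂ ℤ._-_ (expand a) (expand b) ⟩
  (+ (a % p) ℤ.+ + (a / p) ℤ.* + p) ℤ.- (+ (b % p) ℤ.+ + (b / p) ℤ.* + p)
    ≡⟨ cong (λ r → (+ r ℤ.+ + (a / p) ℤ.* + p) ℤ.- (+ (b % p) ℤ.+ + (b / p) ℤ.* + p)) eq ⟩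
  (+ (b % p) ℤ.+ + (a / p) ℤ.* + p) ℤ.- (+ (b % p) ℤ.+ + (b / p) ℤ.* + p)
    ≡⟨ collect (+ (b % p)) (+ (a / p)) (+ (b / p)) (+ p) ⟩
  (+ (a / p) ℤ.- + (b / p)) ℤ.* + p ∎))
  where
  open ≡-Reasoning
  expand : ∀ x → + x ≡ + (x % p) ℤ.+ + (x / p) ℤ.* + p
  expand x = begin
    + x                                 ≡⟨ cong +_ (m≡m%n+[m/n]*n x p) ⟩
    + (x % p + (x / p) * p)             ≡⟨ ℤ.pos-+ (x % p) ((x / p) * p) ⟩
    + (x % p) ℤ.+ + ((x / p) * p)       ≡⟨ cong (λ y → + (x % p) ℤ.+ y) (ℤ.pos-* (x / p) p) ⟩
    + (x % p) ℤ.+ + (x / p) ℤ.* + p     ∎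
  collect : ∀ r s t k → (r ℤ.+ s ℤ.* k) ℤ.- (r ℤ.+ t ℤ.* k) ≡ (s ℤ.- t) ℤ.* k
  collect = ℤ-solve-∀

-- The coefficientwise form of (1 + X)^(a+p) ≡ (1 + X)^a (1 + X^p), in degrees below p and from p on.

[a+p]Ck%p≡aCk%p : ∀ {p} .{{_ : NonZero p}} → Prime p → ∀ a {k} → k < p →
                  ((a + p) C k) % p ≡ (a C k) % p
[a+p]Ck%p≡aCk%p pp a {zero} k<p = refl
[a+p]Ck%p≡aCk%p {p} pp zero {suc k} k<p = begin
  (p C suc k) % p ≡⟨ n∣m⇒m%n≡0 _ p (p∣pC[1+k] pp k<p) ⟩
  0               ≡⟨ n∣m⇒m%n≡0 _ p (p ∣0) ⟨
  0 % p           ≡⟨ cong (_% p) (k>n⇒nCk≡0 (s≤s (z≤n {k}))) ⟨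
  (0 C suc k) % p ∎
  where open ≡-Reasoning
[a+p]Ck%p≡aCk%p {p} pp (suc a) {suc k} k<p = begin
  (suc (a + p) C suc k) % p
    ≡⟨ cong (_% p) (nCk+nC[k+1]≡[n+1]C[k+1] (a + p) k) ⟨
  (((a + p) C k) + ((a + p) C suc k)) % p
    ≡⟨ +-%-cong p ([a+p]Ck%p≡aCk%p pp a (<-trans (n<1+n k) k<p)) ([a+p]Ck%p≡aCk%p pp a k<p) ⟩
  ((a C k) + (a C suc k)) % p
    ≡⟨ cong (_% p) (nCk+nC[k+1]≡[n+1]C[k+1] a k) ⟩
  (suc a C suc k) % p ∎
  where open ≡-Reasoning

[a+p]C[k+p]%p≡[aCk+aC[k+p]]%p : ∀ {p} .{{_ : NonZero p}} → Prime p → ∀ a k →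
  ((a + p) C (k + p)) % p ≡ ((a C k) + (a C (k + p))) % p
[a+p]C[k+p]%p≡[aCk+aC[k+p]]%p {p@(suc q)} pp zero zero = cong (_% p) (begin
  p C p           ≡⟨ nCn≡1 p ⟩
  1 + 0           ≡⟨ cong suc (k>n⇒nCk≡0 (s≤s (z≤n {q}))) ⟨
  1 + (0 C p)     ∎)
  where open ≡-Reasoning
[a+p]C[k+p]%p≡[aCk+aC[k+p]]%p {p} pp zero (suc k) = cong (_% p) (begin
  p C (suc k + p)                   ≡⟨ k>n⇒nCk≡0 (s≤s (m≤n+m p k)) ⟩
  0 + 0                             ≡⟨ cong₂ _+_ (k>n⇒nCk≡0 (s≤s (z≤n {k})))
                                                 (k>n⇒nCk≡0 (s≤s (z≤n {k + p}))) ⟨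
  (0 C suc k) + (0 C (suc k + p))   ∎)
  where open ≡-Reasoning
[a+p]C[k+p]%p≡[aCk+aC[k+p]]%p {p@(suc q)} pp (suc a) zero = begin
  (suc (a + p) C suc q) % p
    ≡⟨ cong (_% p) (nCk+nC[k+1]≡[n+1]C[k+1] (a + p) q) ⟨
  (((a + p) C q) + ((a + p) C p)) % p
    -- Pascal's rule at the bottom index `p` reaches down to `q`, which is below `p`, so the first
    -- summand falls under the preceding lemma. The 1 is `a C 0`.
    ≡⟨ +-%-cong {(a + p) C q} {a C q} {(a + p) C p} {1 + (a C p)} p
         ([a+p]Ck%p≡aCk%p pp a (n<1+n q)) ([a+p]C[k+p]%p≡[aCk+aC[k+p]]%p pp a zero) ⟩
  ((a C q) + (1 + (a C p))) % p
    ≡⟨ cong (_% p) (+-suc (a C q) (a C p)) ⟩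
  (1 + ((a C q) + (a C p))) % p
    ≡⟨ cong (λ x → (1 + x) % p) (nCk+nC[k+1]≡[n+1]C[k+1] a q) ⟩
  (1 + (suc a C p)) % p ∎
  where open ≡-Reasoning
[a+p]C[k+p]%p≡[aCk+aC[k+p]]%p {p} pp (suc a) (suc k) = begin
  (suc (a + p) C suc (k + p)) % p
    ≡⟨ cong (_% p) (nCk+nC[k+1]≡[n+1]C[k+1] (a + p) (k + p)) ⟨
  (((a + p) C (k + p)) + ((a + p) C (suc k + p))) % p
    ≡⟨ +-%-cong p ([a+p]C[k+p]%p≡[aCk+aC[k+p]]%p pp a k)
                  ([a+p]C[k+p]%p≡[aCk+aC[k+p]]%p pp a (suc k)) ⟩
  (((a C k) + (a C (k + p))) + ((a C suc k) + (a C (suc k + p)))) % p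
    ≡⟨ cong (_% p) (interchange (a C k) (a C (k + p)) (a C suc k) (a C (suc k + p))) ⟩
  (((a C k) + (a C suc k)) + ((a C (k + p)) + (a C (suc k + p)))) % p
    ≡⟨ cong₂ (λ x y → (x + y) % p) (nCk+nC[k+1]≡[n+1]C[k+1] a k)
                                   (nCk+nC[k+1]≡[n+1]C[k+1] a (k + p)) ⟩
  ((suc a C suc k) + (suc a C (suc k + p))) % p ∎
  where
  open ≡-Reasoning
  interchange : ∀ w x y z → (w + x) + (y + z) ≡ (w + y) + (x + z)
  interchange = solve-∀

-- In Lucas' theorem a shared last digit `r` contributes the factor C(r, r) = 1. The induction
-- removes one `p` from the top index at a time, which mirrors Pascal's rule on the quotients `a`
-- and `b`.
lucas-equal-digits : ∀ {p r} .{{_ : NonZero p}} → Prime p → r < p → ∀ a b →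
                     ((r + a * p) C (r + b * p)) % p ≡ (a C b) % p
lucas-equal-digits {p} {r} pp r<p zero zero = cong (_% p) (nCn≡1 (r + 0))
lucas-equal-digits {p} {r} pp r<p zero (suc b) = cong (_% p) (begin
  (r + 0) C (r + suc b * p) ≡⟨ k>n⇒nCk≡0 (+-monoʳ-< r (<-≤-trans (≤-<-trans z≤n r<p) (m≤m+n p (b * p)))) ⟩
  0                         ≡⟨ k>n⇒nCk≡0 (s≤s (z≤n {b})) ⟨
  0 C suc b                 ∎)
  where open ≡-Reasoning
lucas-equal-digits {p} {r} pp r<p (suc a) zero = begin
  ((r + (p + a * p)) C (r + 0)) % p
    ≡⟨ cong₂ (λ x y → (x C y) % p) (move r p (a * p)) (+-identityʳ r) ⟩
  (((r + a * p) + p) C r) % p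
    ≡⟨ [a+p]Ck%p≡aCk%p pp (r + a * p) r<p ⟩
  ((r + a * p) C r) % p
    ≡⟨ cong (λ x → ((r + a * p) C x) % p) (+-identityʳ r) ⟨
  ((r + a * p) C (r + 0)) % p
    ≡⟨ lucas-equal-digits pp r<p a zero ⟩
  1 % p ∎
  where
  open ≡-Reasoning
  move : ∀ x y z → x + (y + z) ≡ (x + z) + y
  move = solve-∀
lucas-equal-digits {p} {r} pp r<p (suc a) (suc b) = begin
  ((r + (p + a * p)) C (r + (p + b * p))) % p
    ≡⟨ cong₂ (λ x y → (x C y) % p) (move r p (a * p)) (move r p (b * p)) ⟩
  (((r + a * p) + p) C ((r + b * p) + p)) % p
    ≡⟨ [a+p]C[k+p]%p≡[aCk+aC[k+p]]%p pp (r + a * p) (r + b * p) ⟩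
  (((r + a * p) C (r + b * p)) + ((r + a * p) C ((r + b * p) + p))) % p
    -- The larger bottom index again ends in `r`, now with quotient `suc b`, so the induction
    -- hypothesis covers both summands.
    ≡⟨ cong (λ x → (((r + a * p) C (r + b * p)) + ((r + a * p) C x)) % p) (move r p (b * p)) ⟨
  (((r + a * p) C (r + b * p)) + ((r + a * p) C (r + suc b * p))) % p
    ≡⟨ +-%-cong p (lucas-equal-digits pp r<p a b) (lucas-equal-digits pp r<p a (suc b)) ⟩
  ((a C b) + (a C suc b)) % p
    ≡⟨ cong (_% p) (nCk+nC[k+1]≡[n+1]C[k+1] a b) ⟩
  (suc a C suc b) % p ∎
  where
  open ≡-Reasoning
  move : ∀ x y z → x + (y + z) ≡ (x + z) + y
  move = solve-∀

-- Subtracting one from a positive multiple of `p` gives last digit `p` - 1 and lowers the quotient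
-- by one: `pred (suc a * suc q)` computes to `q + a * suc q`.
lucas-pred : ∀ {p} .{{_ : NonZero p}} → Prime p → ∀ a b .{{_ : NonZero a}} .{{_ : NonZero b}} →
             (pred (a * p) C pred (b * p)) % p ≡ (pred a C pred b) % p
lucas-pred {suc q} pp (suc a) (suc b) = lucas-equal-digits pp (n<1+n q) a b

-- Iteration over powers of p.

x*p^[1+α]≡x*p^α*p : ∀ x p α → x * p ^ suc α ≡ x * p ^ α * p
x*p^[1+α]≡x*p^α*p x p α = rearrange x p (p ^ α)
  where
  rearrange : ∀ x y z → x * (y * z) ≡ x * z * y
  rearrange = solve-∀

[np^α]C[mp^α]%p≡nCm%p : ∀ {p} .{{_ : NonZero p}} → Prime p → ∀ n m α →
                        ((n * p ^ α) C (m * p ^ α)) % p ≡ (n C m) % p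
[np^α]C[mp^α]%p≡nCm%p {p} pp n m zero =
  cong₂ (λ x y → (x C y) % p) (*-identityʳ n) (*-identityʳ m)
[np^α]C[mp^α]%p≡nCm%p {p} pp n m (suc α) = begin
  ((n * p ^ suc α) C (m * p ^ suc α)) % p
    ≡⟨ cong₂ (λ x y → (x C y) % p) (x*p^[1+α]≡x*p^α*p n p α) (x*p^[1+α]≡x*p^α*p m p α) ⟩
  ((n * p ^ α * p) C (m * p ^ α * p)) % p
    -- Both indices end in the digit `r` = 0, which is below `p` because `p` is nonzero.
    ≡⟨ lucas-equal-digits pp (n≢0⇒n>0 (≢-nonZero⁻¹ p)) (n * p ^ α) (m * p ^ α) ⟩
  ((n * p ^ α) C (m * p ^ α)) % p
    ≡⟨ [np^α]C[mp^α]%p≡nCm%p pp n m α ⟩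
  (n C m) % p ∎
  where
  open ≡-Reasoning

-- In base `p`, `pred (n * p ^ α)` is `pred n` followed by `α` digits `p` - 1, and likewise for `m`;
-- each step strips one of these common digits.
[np^α-1]C[mp^α-1]%p≡[n-1]C[m-1]%p :
  ∀ {p} .{{_ : NonZero p}} → Prime p → ∀ n m α .{{_ : NonZero n}} .{{_ : NonZero m}} →
  (pred (n * p ^ α) C pred (m * p ^ α)) % p ≡ (pred n C pred m) % p
[np^α-1]C[mp^α-1]%p≡[n-1]C[m-1]%p {p} pp n m zero =
  cong₂ (λ x y → (pred x C pred y) % p) (*-identityʳ n) (*-identityʳ m)
[np^α-1]C[mp^α-1]%p≡[n-1]C[m-1]%p {p} pp n m (suc α) = begin
  (pred (n * p ^ suc α) C pred (m * p ^ suc α)) % p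
    ≡⟨ cong₂ (λ x y → (pred x C pred y) % p) (x*p^[1+α]≡x*p^α*p n p α) (x*p^[1+α]≡x*p^α*p m p α) ⟩
  (pred (n * p ^ α * p) C pred (m * p ^ α * p)) % p
    ≡⟨ lucas-pred pp (n * p ^ α) (m * p ^ α) ⟩
  (pred (n * p ^ α) C pred (m * p ^ α)) % p
    ≡⟨ [np^α-1]C[mp^α-1]%p≡[n-1]C[m-1]%p pp n m α ⟩
  (pred n C pred m) % p ∎
  where
  open ≡-Reasoning
  instance
    _ = m^n≢0 p α
    _ = m*n≢0 n (p ^ α)
    _ = m*n≢0 m (p ^ α)

-- From divisibility by p to divisibility by n p.

-- Cancelling `k` from absorption leaves the multipliers `m` and `n`, the same as for the unscaled
-- indices, so the two identities can be subtracted.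
m*[nk]C[mk]≡n*[nk-1]C[mk-1] : ∀ n m k .{{_ : NonZero n}} .{{_ : NonZero m}} .{{_ : NonZero k}} →
  m * ((n * k) C (m * k)) ≡ n * (pred (n * k) C pred (m * k))
m*[nk]C[mk]≡n*[nk-1]C[mk-1] n m k = *-cancelˡ-≡ _ _ k (begin
  k * (m * c)       ≡⟨ rearrange k m c ⟩
  (m * k) * c       ≡⟨ k*nCk≡n*[n-1]C[k-1] (n * k) (m * k) ⟩
  (n * k) * c′      ≡⟨ rearrange k n c′ ⟨
  k * (n * c′)      ∎)
  where
  open ≡-Reasoning
  instance
    _ = m*n≢0 n k
    _ = m*n≢0 m k
  c  = (n * k) C (m * k)
  c′ = pred (n * k) C pred (m * k)
  rearrange : ∀ x y z → x * (y * z) ≡ (y * x) * z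
  rearrange = solve-∀

k*∣x-y∣≡∣kx-ky∣ : ∀ k x y → k * ∣ + x ℤ.- + y ∣ ≡ ∣ + (k * x) ℤ.- + (k * y) ∣
k*∣x-y∣≡∣kx-ky∣ k x y = begin
  k * ∣ + x ℤ.- + y ∣                  ≡⟨ ℤ.abs-* (+ k) (+ x ℤ.- + y) ⟨
  ∣ + k ℤ.* (+ x ℤ.- + y) ∣            ≡⟨ cong ∣_∣ (distrib (+ k) (+ x) (+ y)) ⟩
  ∣ + k ℤ.* + x ℤ.- + k ℤ.* + y ∣      ≡⟨ cong₂ (λ u v → ∣ u ℤ.- v ∣) (ℤ.pos-* k x) (ℤ.pos-* k y) ⟨
  ∣ + (k * x) ℤ.- + (k * y) ∣          ∎
  where
  open ≡-Reasoning
  distrib : ∀ a b c → a ℤ.* (b ℤ.- c) ≡ a ℤ.* b ℤ.- a ℤ.* c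
  distrib = ℤ-solve-∀

n*p∣m*d∧p∣d⇒n*p∣d : ∀ {n m p d} .{{_ : NonZero n}} → Coprime n m → Prime p →
                    n * p ∣ m * d → p ∣ d → n * p ∣ d
n*p∣m*d∧p∣d⇒n*p∣d {n} {m} {p} {d} c pp np∣md p∣d
  with coprime-divisor c (∣-trans (m∣m*n p) np∣md)
... | divides q refl = subst (n * p ∣_) (*-comm n q) (*-monoʳ-∣ n p∣q)
  where
  rearrange : ∀ x y z → x * (y * z) ≡ z * (x * y)
  rearrange = solve-∀
  p∣q : p ∣ q
  -- With `d` = `q * n`, cancelling `n` from `n * p ∣ m * d` leaves `p ∣ m * q`.
  p∣q with euclidsLemma m q pp (*-cancelˡ-∣ n (subst (n * p ∣_) (rearrange m q n) np∣md))
  ... | inj₂ p∣q = p∣q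
  -- If `p ∣ m`, nothing about `q` follows yet; `p ∣ d` supplies it, since `p ∣ n` as well would
  -- force `p` to be 1.
  ... | inj₁ p∣m with euclidsLemma q n pp p∣d
  ...   | inj₁ p∣q = p∣q
  ...   | inj₂ p∣n = contradiction (subst Prime (c (p∣n , p∣m)) pp) ¬prime[1]

corollary3 : (n m : ℕ) → 1 ≤ n → 1 ≤ m → Coprime n m → m ≤ n →
    (p α : ℕ) → Prime p → 1 ≤ α →
    ((n * p ^ α) C (m * p ^ α)) ≡ (n C m) [mod (n * p) ]
corollary3 n m 1≤n 1≤m c _ p α pp _ =
  n*p∣m*d∧p∣d⇒n*p∣d c pp
    (subst (n * p ∣_) (sym m*D≡n*E)
      (*-monoʳ-∣ n (%-≡⇒≡[mod] p ([np^α-1]C[mp^α-1]%p≡[n-1]C[m-1]%p pp n m α))))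
    (%-≡⇒≡[mod] p ([np^α]C[mp^α]%p≡nCm%p pp n m α))
  where
  open ≡-Reasoning
  instance
    _ = >-nonZero 1≤n
    _ = >-nonZero 1≤m
    _ = prime⇒nonZero pp
    _ = m^n≢0 p α
  N = n * p ^ α
  M = m * p ^ α
  -- Stated with absolute values because the congruence unfolds to divisibility of the absolute
  -- value of the difference.
  m*D≡n*E : m * ∣ + (N C M) ℤ.- + (n C m) ∣
          ≡ n * ∣ + (pred N C pred M) ℤ.- + (pred n C pred m) ∣
  m*D≡n*E = begin
    m * ∣ + (N C M) ℤ.- + (n C m) ∣
      ≡⟨ k*∣x-y∣≡∣kx-ky∣ m (N C M) (n C m) ⟩
    ∣ + (m * (N C M)) ℤ.- + (m * (n C m)) ∣
      ≡⟨ cong₂ (λ x y → ∣ + x ℤ.- + y ∣) (m*[nk]C[mk]≡n*[nk-1]C[mk-1] n m (p ^ α))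
                                         (k*nCk≡n*[n-1]C[k-1] n m) ⟩
    ∣ + (n * (pred N C pred M)) ℤ.- + (n * (pred n C pred m)) ∣
      ≡⟨ k*∣x-y∣≡∣kx-ky∣ n (pred N C pred M) (pred n C pred m) ⟨
    n * ∣ + (pred N C pred M) ℤ.- + (pred n C pred m) ∣ ∎
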